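{- Let $k\ge 2$ be an integer and let $G$ be a fixed graph with $\chi(G)\ge 2$. For every fixed $\epsilon>0$ there exists $n_0$ such that for all $n\ge n_0$, $$\hat{\mathrm{ex}}_k(n,G)\le\left(1-\frac{1}{\chi(G)-1}+\epsilon\right)\binom{n}{2}.$$
   Context: A $k$-graph is a hypergraph all of whose edges have exactly $k$ vertices. The shadow $\partial(\mathcal{H})$ of a hypergraph $\mathcal{H}$ is the simple graph on $V(\mathcal{H})$ in which $uv$ is an edge iff $\{u,v\}\subseteq h$ for some edge $h$ of $\mathcal{H}$. For a simple graph $G$, a hypergraph $\mathcal{H}$ is a Berge-$G$ if there is an injection $i:V(G)\to V(\mathcal{H})$ and a bijection $f:E(G)\to E(\mathcal{H})$ with $\{i(u),i(v)\}\subseteq f(uv)$ for every $uv\in E(G)$; $\mathcal{H}$ is Berge-$G$-free if no subhypergraph of it is a Berge-$G$. $\hat{\mathrm{ex}}_k(n,G)$ is the maximum number of edges of $\partial(\mathcal{H})$ over all Berge-$G$-free $k$-graphs $\mathcal{H}$ on $n$ vertices. $\chi(G)$ is the chromatic number. -}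

module Defs where

open import Data.Nat using (ℕ; zero; suc; _<_; _<ᵇ_)
open import Data.Bool using (Bool; true; false; _∧_; if_then_else_)
open import Data.Fin using (Fin; toℕ)
open import Data.Fin.Subset using (Subset; _∈_; ∣_∣)
open import Data.Vec using (lookup)
open import Data.Bool.ListAction using (any)
open import Data.List using (List; []; _∷_; length; filterᵇ; concatMap; allFin)
import Data.List as L
open import Data.List.Relation.Unary.All using (All)
open import Data.List.Relation.Unary.Unique.Propositional using (Unique)
open import Data.Product using (_×_; _,_; Σ; ∃; proj₁; proj₂)
open import Relation.Binary.PropositionalEquality using (_≡_; _≢_)
open import Relation.Nullary using (¬_)
open import Function.Definitions using (Injective)

record SimpleGraph (m : ℕ) : Set where
  field
    edges   : List (Fin m × Fin m)
    ordered : All (λ e → toℕ (proj₁ e) < toℕ (proj₂ e)) edges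
    unique  : Unique edges
open SimpleGraph public

Colorable : ∀ {m} → SimpleGraph m → ℕ → Set
Colorable {m} G c =
  Σ (Fin m → Fin c) λ col →
    All (λ e → col (proj₁ e) ≢ col (proj₂ e)) (edges G)

ChromaticNumber : ∀ {m} → SimpleGraph m → ℕ → Set
ChromaticNumber G c = Colorable G c × (∀ d → Colorable G d → c Data.Nat.≤ d)

record KGraph (k n : ℕ) : Set where
  field
    hedges   : List (Subset n)
    uniformE : All (λ h → ∣ h ∣ ≡ k) hedges
    uniqueE  : Unique hedges
open KGraph public

-- H contains a Berge-G as a subhypergraph: an injection i of V(G) into V(H)
-- and an injection f of E(G) into E(H) (i.e. a bijection onto a
-- subhypergraph) such that {i(u), i(v)} ⊆ f(uv) for every edge uv of G.
ContainsBerge : ∀ {k n m} → KGraph k n → SimpleGraph m → Set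
ContainsBerge {k} {n} {m} H G =
  Σ (Fin m → Fin n) λ i →
  Σ (Fin (length (edges G)) → Fin (length (hedges H))) λ f →
    Injective _≡_ _≡_ i × Injective _≡_ _≡_ f ×
    (∀ j → (i (proj₁ (L.lookup (edges G) j)) ∈ L.lookup (hedges H) (f j))
         × (i (proj₂ (L.lookup (edges G) j)) ∈ L.lookup (hedges H) (f j)))

BergeFree : ∀ {k n m} → KGraph k n → SimpleGraph m → Set
BergeFree H G = ¬ ContainsBerge H G

pairs : (n : ℕ) → List (Fin n × Fin n)
pairs n = concatMap (λ u → concatMap (λ v → if toℕ u <ᵇ toℕ v then (u , v) ∷ [] else [])
                                       (allFin n)) (allFin n)

shadowSize : ∀ {k n} → KGraph k n → ℕ
shadowSize {k} {n} H =
  length (filterᵇ (λ p → any (λ h → lookup h (proj₁ p) ∧ lookup h (proj₂ p)) (hedges H))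
                  (pairs n))

{-# OPTIONS --safe #-}
-- Call two vertices adjacent if some hyperedge contains both, and let N_s be the
-- number of ordered s-cliques. The Moon–Moser inequality
--   s N_s² ≤ N_{s-1} (n N_s + (s-1) N_{s+1})
-- propagates an edge density above 1 - 1/(χ-1) to N_χ ≥ c n^χ. By convexity
-- there are then at least c' n^{χm} complete χ-partite configurations with m
-- (not necessarily distinct) vertices in each part. Fix for each adjacent pair
-- a hyperedge containing it. The configurations in which some chosen vertex
-- coincides with another one, or lies in the hyperedge fixed for two others,
-- number only O(n^{χm-1}). Any remaining configuration is a Berge-G: place u in
-- the part of its colour, and send each edge to the hyperedge fixed for it; two
-- edges of G cannot share a hyperedge, since it would contain a third vertex.
module Submission where

open import Defs
open import Data.Nat using (ℕ; suc; _≥_)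
open import Data.Nat.Combinatorics using (_C_)
open import Data.Product using (∃)
open import Relation.Binary.PropositionalEquality using (_≡_; cong; cong₂)

module Counting where

  open import Data.Bool using (Bool; true; false; _∧_; if_then_else_)
  open import Data.Bool.ListAction using (any)
  open import Data.Bool.Properties using (T-≡; T-∧)
  open import Data.Fin using (Fin; zero; suc; toℕ)
  open import Data.Fin.Properties using (_≟_; any?)
  open import Data.Fin.Subset using (Subset; _∈_; _∉_; ∣_∣; ⊥; ⁅_⁆)
  open import Data.Fin.Subset.Properties using (_∈?_; ∣⊥∣≡0; ∣⁅x⁆∣≡1; x∈⁅x⁆)
  open import Data.List using (List; []; _∷_; _++_; length; map; concatMap; allFin; filterᵇ)
  import Data.List as L
  open import Data.List.Membership.Propositional.Properties using (∈-lookup)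
  open import Data.List.Properties using (map-tabulate; length-tabulate)
  open import Data.List.Relation.Unary.All as All using ()
  open import Data.List.Relation.Unary.AllPairs using (_∷_)
  open import Data.List.Relation.Unary.Any as Any using ()
  open import Data.List.Relation.Unary.Any.Properties using (any⁻; lookup-index)
  open import Data.List.Relation.Unary.Unique.Propositional using (Unique)
  open import Data.Nat using (zero; _+_; _*_; _^_; _≤_; _<_; _<ᵇ_; _≤?_; z≤n; s≤s; s≤s⁻¹; z<s; NonZero; >-nonZero; >-nonZero⁻¹)
  open import Data.Nat.Combinatorics using (nC1≡n; nCk+nC[k+1]≡[n+1]C[k+1])
  open import Data.Nat.Properties hiding (_≟_)
  open import Data.Nat.Tactic.RingSolver using (solve-∀)
  open import Data.Product using (_×_; _,_; proj₁; proj₂)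
  open import Data.Sum using (_⊎_; inj₁; inj₂)
  open import Data.Vec using (Vec; []; _∷_; lookup; zipWith; _[_]≔_; replicate; insertAt; removeAt)
  open import Data.Vec.Properties using (lookup∘update; lookup∘update′; lookup-zipWith; lookup-replicate; []=⇒lookup; lookup⇒[]=; removeAt-insertAt)
  open import Function using (id; mk⇔; Equivalence)
  open import Relation.Binary.PropositionalEquality using (_≢_; refl; sym; trans; subst; module ≡-Reasoning)
  open import Relation.Nullary using (Dec; yes; no; does; contradiction; ¬?; _×-dec_)
  open import Relation.Nullary.Decidable using (does-⇔; dec-true)

  private variable
    A B : Set

  -- Finite sums over lists and over tuples

  ∑ : List A → (A → ℕ) → ℕ
  ∑ []       f = 0
  ∑ (x ∷ xs) f = f x + ∑ xs f

  ∑-cong : ∀ (xs : List A) {f g : A → ℕ} → (∀ x → f x ≡ g x) → ∑ xs f ≡ ∑ xs g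
  ∑-cong []       e = refl
  ∑-cong (x ∷ xs) e = cong₂ _+_ (e x) (∑-cong xs e)

  ∑-mono : ∀ (xs : List A) {f g : A → ℕ} → (∀ x → f x ≤ g x) → ∑ xs f ≤ ∑ xs g
  ∑-mono []       le = z≤n
  ∑-mono (x ∷ xs) le = +-mono-≤ (le x) (∑-mono xs le)

  ∑-const : ∀ (xs : List A) c → ∑ xs (λ _ → c) ≡ length xs * c
  ∑-const []       c = refl
  ∑-const (x ∷ xs) c = cong (c +_) (∑-const xs c)

  ∑-*ˡ : ∀ (xs : List A) c f → ∑ xs (λ x → c * f x) ≡ c * ∑ xs f
  ∑-*ˡ []       c f = sym (*-zeroʳ c)
  ∑-*ˡ (x ∷ xs) c f = trans (cong (c * f x +_) (∑-*ˡ xs c f)) (sym (*-distribˡ-+ c (f x) _))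

  ∑-*ʳ : ∀ (xs : List A) f c → ∑ xs (λ x → f x * c) ≡ ∑ xs f * c
  ∑-*ʳ []       f c = refl
  ∑-*ʳ (x ∷ xs) f c = trans (cong (f x * c +_) (∑-*ʳ xs f c)) (sym (*-distribʳ-+ c (f x) _))

  ∑-+ : ∀ (xs : List A) f g → ∑ xs (λ x → f x + g x) ≡ ∑ xs f + ∑ xs g
  ∑-+ []       f g = refl
  ∑-+ (x ∷ xs) f g = trans (cong (f x + g x +_) (∑-+ xs f g)) (interchange (f x) (g x) (∑ xs f) (∑ xs g))
    where
    interchange : ∀ a b c d → (a + b) + (c + d) ≡ (a + c) + (b + d)
    interchange = solve-∀

  ∑-swap : ∀ (xs : List A) (ys : List B) (f : A → B → ℕ) →
           ∑ xs (λ x → ∑ ys (f x)) ≡ ∑ ys (λ y → ∑ xs (λ x → f x y))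
  ∑-swap []       ys f = sym (trans (∑-const ys 0) (*-zeroʳ (length ys)))
  ∑-swap (x ∷ xs) ys f =
    trans (cong (∑ ys (f x) +_) (∑-swap xs ys f)) (sym (∑-+ ys (f x) _))

  ∑-++ : ∀ (xs ys : List A) f → ∑ (xs ++ ys) f ≡ ∑ xs f + ∑ ys f
  ∑-++ []       ys f = refl
  ∑-++ (x ∷ xs) ys f = trans (cong (f x +_) (∑-++ xs ys f)) (sym (+-assoc (f x) _ _))

  ∑-map : ∀ (xs : List A) (h : A → B) f → ∑ (map h xs) f ≡ ∑ xs (λ x → f (h x))
  ∑-map []       h f = refl
  ∑-map (x ∷ xs) h f = cong (f (h x) +_) (∑-map xs h f)

  ∑-concatMap : ∀ (xs : List A) (h : A → List B) f →
                ∑ (concatMap h xs) f ≡ ∑ xs (λ x → ∑ (h x) f)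
  ∑-concatMap []       h f = refl
  ∑-concatMap (x ∷ xs) h f =
    trans (∑-++ (h x) (concatMap h xs) f) (cong (∑ (h x) f +_) (∑-concatMap xs h f))

  tuples : List A → ∀ s → List (Vec A s)
  tuples xs zero    = [] ∷ []
  tuples xs (suc s) = concatMap (λ x → map (x ∷_) (tuples xs s)) xs

  ∑-tuples : ∀ (xs : List A) s (F : Vec A (suc s) → ℕ) →
             ∑ (tuples xs (suc s)) F ≡ ∑ xs (λ x → ∑ (tuples xs s) (λ v → F (x ∷ v)))
  ∑-tuples xs s F =
    trans (∑-concatMap xs _ F) (∑-cong xs (λ x → ∑-map (tuples xs s) (x ∷_) F))

  length-∑ : ∀ (xs : List A) → length xs ≡ ∑ xs (λ _ → 1)
  length-∑ xs = sym (trans (∑-const xs 1) (*-identityʳ _))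

  length-tuples : ∀ (xs : List A) s → length (tuples xs s) ≡ length xs ^ s
  length-tuples xs zero    = refl
  length-tuples xs (suc s) = begin
    length (tuples xs (suc s))                   ≡⟨ length-∑ (tuples xs (suc s)) ⟩
    ∑ (tuples xs (suc s)) (λ _ → 1)              ≡⟨ ∑-tuples xs s _ ⟩
    ∑ xs (λ _ → ∑ (tuples xs s) (λ _ → 1))       ≡⟨ ∑-const xs _ ⟩
    length xs * ∑ (tuples xs s) (λ _ → 1)        ≡⟨ cong (length xs *_) (sym (length-∑ (tuples xs s))) ⟩
    length xs * length (tuples xs s)             ≡⟨ cong (length xs *_) (length-tuples xs s) ⟩
    length xs ^ suc s                            ∎
    where open ≡-Reasoning

  ∏ : ∀ {t} → Vec A t → (A → ℕ) → ℕ
  ∏ []       f = 1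
  ∏ (x ∷ xs) f = f x * ∏ xs f

  ∑-^ : ∀ (xs : List A) t f → ∑ xs f ^ t ≡ ∑ (tuples xs t) (λ v → ∏ v f)
  ∑-^ xs zero    f = refl
  ∑-^ xs (suc t) f = begin
    ∑ xs f * ∑ xs f ^ t                                       ≡⟨ cong (∑ xs f *_) (∑-^ xs t f) ⟩
    ∑ xs f * ∑ (tuples xs t) (λ v → ∏ v f)                    ≡⟨ sym (∑-*ʳ xs f _) ⟩
    ∑ xs (λ x → f x * ∑ (tuples xs t) (λ v → ∏ v f))          ≡⟨ ∑-cong xs (λ x → sym (∑-*ˡ (tuples xs t) (f x) _)) ⟩
    ∑ xs (λ x → ∑ (tuples xs t) (λ v → f x * ∏ v f))          ≡⟨ sym (∑-tuples xs t _) ⟩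
    ∑ (tuples xs (suc t)) (λ v → ∏ v f)                       ∎
    where open ≡-Reasoning

  ∑*∑ : ∀ (xs : List A) (ys : List B) f g → ∑ xs f * ∑ ys g ≡ ∑ xs (λ x → ∑ ys (λ y → f x * g y))
  ∑*∑ xs ys f g = trans (sym (∑-*ʳ xs f _)) (∑-cong xs (λ x → sym (∑-*ˡ ys (f x) g)))

  -- Chebyshev's sum inequality and power means

  -- Writing `b` as `a + u` and `d` as `c + v`, the right side exceeds the left by `u * v`.
  rearrange : ∀ {a b c d} → a ≤ b → c ≤ d → a * d + b * c ≤ a * c + b * d
  rearrange {a} {b} {c} {d} a≤b c≤d with m≤n⇒∃[o]m+o≡n a≤b | m≤n⇒∃[o]m+o≡n c≤d
  ... | (u , refl) | (v , refl) = ≤-trans (m≤m+n _ (u * v)) (≤-reflexive (eq a u c v))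
    where
    eq : ∀ a u c v → (a * (c + v) + (a + u) * c) + u * v ≡ a * c + (a + u) * (c + v)
    eq = solve-∀

  rearrange-^ : ∀ t a b → a * b ^ t + b * a ^ t ≤ a * a ^ t + b * b ^ t
  rearrange-^ t a b with ≤-total a b
  ... | inj₁ a≤b = rearrange a≤b (^-monoˡ-≤ t a≤b)
  ... | inj₂ b≤a = begin
    a * b ^ t + b * a ^ t ≡⟨ +-comm (a * b ^ t) _ ⟩
    b * a ^ t + a * b ^ t ≤⟨ rearrange b≤a (^-monoˡ-≤ t b≤a) ⟩
    b * b ^ t + a * a ^ t ≡⟨ +-comm (b * b ^ t) _ ⟩
    a * a ^ t + b * b ^ t ∎
    where open ≤-Reasoning

  -- Chebyshev's sum inequality with weights `w`, for the similarly ordered families `a x` and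
  -- `a x ^ t`. Both products become double sums; doubling symmetrises them in `x` and `y`, after
  -- which each pair is an instance of `rearrange-^`. The weights will be clique indicators in
  -- Cauchy-Schwarz and 1 in the power mean.
  chebyshev : ∀ (xs : List A) t (w a : A → ℕ) →
              ∑ xs (λ x → w x * a x) * ∑ xs (λ x → w x * a x ^ t) ≤
              ∑ xs w * ∑ xs (λ x → w x * a x ^ suc t)
  chebyshev xs t w a = *-cancelˡ-≤ 2 (begin
    2 * (p * q)                                          ≡⟨ double (p * q) ⟩
    p * q + p * q                                        ≡⟨ cong (p * q +_) (*-comm p q) ⟩
    p * q + q * p                                        ≡⟨ cong₂ _+_ (∑*∑ xs xs _ _) (∑*∑ xs xs _ _) ⟩
    ∑∑ (λ x y → (w x * a x) * (w y * b y)) + ∑∑ (λ x y → (w x * b x) * (w y * a y))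
                                                         ≡⟨ sym (∑∑-+ _ _) ⟩
    ∑∑ (λ x y → (w x * a x) * (w y * b y) + (w x * b x) * (w y * a y))
                                                         ≤⟨ ∑-mono xs (λ x → ∑-mono xs (λ y → pointwise x y)) ⟩
    ∑∑ (λ x y → w x * (w y * (a y * b y)) + (w x * (a x * b x)) * w y)
                                                         ≡⟨ ∑∑-+ _ _ ⟩
    ∑∑ (λ x y → w x * (w y * (a y * b y))) + ∑∑ (λ x y → (w x * (a x * b x)) * w y)
                                                         ≡⟨ sym (cong₂ _+_ (∑*∑ xs xs _ _) (∑*∑ xs xs _ _)) ⟩
    u * s + s * u                                        ≡⟨ cong (u * s +_) (*-comm s u) ⟩
    u * s + u * s                                        ≡⟨ sym (double (u * s)) ⟩
    2 * (u * s)                                          ∎)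
    where
    open ≤-Reasoning
    b = λ x → a x ^ t
    p = ∑ xs (λ x → w x * a x)
    q = ∑ xs (λ x → w x * b x)
    u = ∑ xs w
    s = ∑ xs (λ x → w x * (a x * b x))
    ∑∑ = λ (f : _ → _ → ℕ) → ∑ xs (λ x → ∑ xs (f x))
    ∑∑-+ : ∀ f g → ∑∑ (λ x y → f x y + g x y) ≡ ∑∑ f + ∑∑ g
    ∑∑-+ f g = trans (∑-cong xs (λ x → ∑-+ xs (f x) (g x))) (∑-+ xs _ _)
    double : ∀ n → 2 * n ≡ n + n
    double = solve-∀
    left : ∀ w v a b c d → (w * a) * (v * d) + (w * c) * (v * b) ≡ (w * v) * (a * d + b * c)
    left = solve-∀
    right : ∀ w v a b c d → (w * v) * (a * c + b * d) ≡ w * (v * (b * d)) + (w * (a * c)) * v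
    right = solve-∀
    pointwise : ∀ x y → (w x * a x) * (w y * b y) + (w x * b x) * (w y * a y) ≤
                        w x * (w y * (a y * b y)) + (w x * (a x * b x)) * w y
    pointwise x y = begin
      (w x * a x) * (w y * b y) + (w x * b x) * (w y * a y) ≡⟨ left (w x) (w y) (a x) (a y) (b x) (b y) ⟩
      (w x * w y) * (a x * b y + a y * b x)                 ≤⟨ *-monoʳ-≤ (w x * w y) (rearrange-^ t (a x) (a y)) ⟩
      (w x * w y) * (a x * b x + a y * b y)                 ≡⟨ right (w x) (w y) (a x) (a y) (b x) (b y) ⟩
      w x * (w y * (a y * b y)) + (w x * (a x * b x)) * w y ∎

  -- The power mean inequality with denominators cleared, `M / D` being a lower bound for the mean
  -- of `a`. Induction on `t`, each step by `chebyshev` with unit weights.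
  power-mean : ∀ (xs : List A) t (a : A → ℕ) D M →
               length xs * M ≤ D * ∑ xs a → length xs * M ^ t ≤ D ^ t * ∑ xs (λ x → a x ^ t)
  power-mean []           t       a D M le = z≤n
  power-mean xs           zero    a D M le = ≤-reflexive (begin
    length xs * 1         ≡⟨ sym (∑-const xs 1) ⟩
    ∑ xs (λ _ → 1)        ≡⟨ sym (*-identityˡ _) ⟩
    1 * ∑ xs (λ _ → 1)    ∎)
    where open ≡-Reasoning
  -- The extra factor `L` lets the hypothesis and the induction hypothesis be multiplied; the list
  -- is nonempty here, so `L` can be cancelled.
  power-mean xs@(_ ∷ xs′) (suc t) a D M le = *-cancelˡ-≤ L (begin
    L * (L * (M * M ^ t))       ≡⟨ e₁ L M (M ^ t) ⟩
    (L * M) * (L * M ^ t)       ≤⟨ *-mono-≤ le (power-mean xs t a D M le) ⟩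
    (D * p) * (D ^ t * q)       ≡⟨ e₂ D p (D ^ t) q ⟩
    (D * D ^ t) * (p * q)       ≤⟨ *-monoʳ-≤ (D * D ^ t) cheb ⟩
    (D * D ^ t) * (L * s)       ≡⟨ e₃ (D * D ^ t) L s ⟩
    L * ((D * D ^ t) * s)       ∎)
    where
    open ≤-Reasoning
    L = length xs
    p = ∑ xs a
    q = ∑ xs (λ x → a x ^ t)
    s = ∑ xs (λ x → a x ^ suc t)
    1* : ∀ f → ∑ xs (λ x → 1 * f x) ≡ ∑ xs f
    1* f = ∑-cong xs (λ x → *-identityˡ (f x))
    cheb : p * q ≤ L * s
    cheb = begin
      p * q                                     ≡⟨ sym (cong₂ _*_ (1* a) (1* _)) ⟩
      ∑ xs (λ x → 1 * a x) * ∑ xs (λ x → 1 * a x ^ t)   ≤⟨ chebyshev xs t (λ _ → 1) a ⟩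
      ∑ xs (λ _ → 1) * ∑ xs (λ x → 1 * a x ^ suc t)     ≡⟨ cong₂ _*_ (sym (length-∑ xs)) (1* _) ⟩
      L * s                                     ∎
    e₁ : ∀ l m n → l * (l * (m * n)) ≡ (l * m) * (l * n)
    e₁ = solve-∀
    e₂ : ∀ d p e q → (d * p) * (e * q) ≡ (d * e) * (p * q)
    e₂ = solve-∀
    e₃ : ∀ d l s → d * (l * s) ≡ l * (d * s)
    e₃ = solve-∀

  -- Singling out one coordinate of a tuple

  ∑-allFin : ∀ n (f : Fin (suc n) → ℕ) → ∑ (allFin (suc n)) f ≡ f zero + ∑ (allFin n) (λ i → f (suc i))
  ∑-allFin n f = cong (f zero +_)
    (trans (cong (λ is → ∑ is f) (sym (map-tabulate id suc))) (∑-map (allFin n) suc f))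

  -- Any coordinate can be made the innermost summation variable; the clique counts need this for
  -- every position of the exchanged vertex.
  ∑-insertAt : ∀ (xs : List A) s (i : Fin (suc s)) (F : Vec A (suc s) → ℕ) →
               ∑ (tuples xs (suc s)) F ≡ ∑ (tuples xs s) (λ v → ∑ xs (λ y → F (insertAt v i y)))
  ∑-insertAt xs s       zero    F = trans (∑-tuples xs s F) (∑-swap xs (tuples xs s) _)
  ∑-insertAt xs (suc s) (suc i) F = begin
    ∑ (tuples xs (suc (suc s))) F                                                     ≡⟨ ∑-tuples xs (suc s) F ⟩
    ∑ xs (λ x → ∑ (tuples xs (suc s)) (λ v → F (x ∷ v)))                              ≡⟨ ∑-cong xs (λ x → ∑-insertAt xs s i _) ⟩
    ∑ xs (λ x → ∑ (tuples xs s) (λ v → ∑ xs (λ y → F (x ∷ insertAt v i y))))          ≡⟨ sym (∑-tuples xs s _) ⟩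
    ∑ (tuples xs (suc s)) (λ v → ∑ xs (λ y → F (insertAt v (suc i) y)))               ∎
    where open ≡-Reasoning

  *-leftComm : ∀ a b c → a * (b * c) ≡ b * (a * c)
  *-leftComm = solve-∀

  ∏-insertAt : ∀ {s} (v : Vec A s) i y f → ∏ (insertAt v i y) f ≡ f y * ∏ v f
  ∏-insertAt v       zero    y f = refl
  ∏-insertAt (x ∷ v) (suc i) y f = trans (cong (f x *_) (∏-insertAt v i y f)) (*-leftComm (f x) (f y) _)

  ∏-≤1 : ∀ {s} (v : Vec A s) {f} → (∀ x → f x ≤ 1) → ∏ v f ≤ 1
  ∏-≤1 []      f≤1 = ≤-refl
  ∏-≤1 (x ∷ v) f≤1 = *-mono-≤ (f≤1 x) (∏-≤1 v f≤1)

  -- If two factors vanish, so do all these products; if exactly one factor vanishes, one product survives.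
  ∑-∏-removeAt : ∀ s (v : Vec A (suc s)) {f} → (∀ x → f x ≤ 1) →
                 ∑ (allFin (suc s)) (λ i → ∏ (removeAt v i) f) ≤ 1 + s * ∏ v f
  ∑-∏-removeAt zero    (x ∷ []) f≤1 = ≤-refl
  ∑-∏-removeAt (suc s) (x ∷ v@(_ ∷ _)) {f} f≤1 = begin
    ∑ (allFin (suc (suc s))) (λ i → ∏ (removeAt (x ∷ v) i) f)          ≡⟨ ∑-allFin (suc s) (λ i → ∏ (removeAt (x ∷ v) i) f) ⟩
    ∏ v f + ∑ (allFin (suc s)) (λ i → f x * ∏ (removeAt v i) f)        ≡⟨ cong (∏ v f +_) (∑-*ˡ (allFin (suc s)) (f x) _) ⟩
    ∏ v f + f x * ∑ (allFin (suc s)) (λ i → ∏ (removeAt v i) f)        ≤⟨ +-monoʳ-≤ (∏ v f) (*-monoʳ-≤ (f x) (∑-∏-removeAt s v f≤1)) ⟩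
    ∏ v f + f x * (1 + s * ∏ v f)                                      ≤⟨ bound (f x) (∏ v f) (f≤1 x) (∏-≤1 v f≤1) ⟩
    1 + suc s * (f x * ∏ v f)                                          ∎
    where
    open ≤-Reasoning
    eq : ∀ s p → p + 1 * (1 + s * p) ≡ 1 + (1 + s) * (1 * p)
    eq = solve-∀
    bound : ∀ a p → a ≤ 1 → p ≤ 1 → p + a * (1 + s * p) ≤ 1 + suc s * (a * p)
    bound zero          p _ p≤1 = ≤-trans (≤-reflexive (+-identityʳ p)) (≤-trans p≤1 (m≤m+n 1 _))
    bound (suc zero)    p _ _   = ≤-reflexive (eq s p)
    bound (suc (suc _)) p (s≤s ()) _

  -- Ordered cliques and the Moon-Moser inequality

  module Cliques {V : Set} (vs : List V) (E : V → V → ℕ)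
                 (E-sym : ∀ x y → E x y ≡ E y x) (E≤1 : ∀ x y → E x y ≤ 1) where

    N = length vs

    -- The indicator of an ordered clique. `E` may have loops, and a vertex with a loop may be
    -- repeated.
    clique : ∀ {s} → Vec V s → ℕ
    clique []      = 1
    clique (x ∷ v) = ∏ v (E x) * clique v

    clique-≤1 : ∀ {s} (v : Vec V s) → clique v ≤ 1
    clique-≤1 []      = ≤-refl
    clique-≤1 (x ∷ v) = *-mono-≤ (∏-≤1 v (E≤1 x)) (clique-≤1 v)

    -- By the symmetry of `E`, it does not matter where the new vertex is inserted.
    clique-insertAt : ∀ {s} (v : Vec V s) i y → clique (insertAt v i y) ≡ ∏ v (E y) * clique v
    clique-insertAt v       zero    y = refl
    clique-insertAt (x ∷ v) (suc i) y = begin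
      ∏ (insertAt v i y) (E x) * clique (insertAt v i y)         ≡⟨ cong₂ _*_ (∏-insertAt v i y (E x)) (clique-insertAt v i y) ⟩
      (E x y * ∏ v (E x)) * (∏ v (E y) * clique v)               ≡⟨ cong (λ e → (e * ∏ v (E x)) * (∏ v (E y) * clique v)) (E-sym x y) ⟩
      (E y x * ∏ v (E x)) * (∏ v (E y) * clique v)               ≡⟨ eq (E y x) _ _ _ ⟩
      (E y x * ∏ v (E y)) * (∏ v (E x) * clique v)               ∎
      where
      open ≡-Reasoning
      eq : ∀ a b c d → (a * b) * (c * d) ≡ (a * c) * (b * d)
      eq = solve-∀

    -- The number of common neighbours of the entries of `v`.
    degree : ∀ {s} → Vec V s → ℕ
    degree v = ∑ vs (λ y → ∏ v (E y))

    #cliques : ℕ → ℕ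
    #cliques s = ∑ (tuples vs s) clique

    #cliques-suc : ∀ s → #cliques (suc s) ≡ ∑ (tuples vs s) (λ v → clique v * degree v)
    #cliques-suc s = begin
      #cliques (suc s)                                            ≡⟨ ∑-insertAt vs s zero clique ⟩
      ∑ (tuples vs s) (λ v → ∑ vs (λ y → ∏ v (E y) * clique v))   ≡⟨ ∑-cong (tuples vs s) (λ v → trans (∑-*ʳ vs _ (clique v)) (*-comm _ (clique v))) ⟩
      ∑ (tuples vs s) (λ v → clique v * degree v)                 ∎
      where open ≡-Reasoning

    -- Both sides count pairs of (s+1)-cliques sharing s vertices.
    ∑-degree² : ∀ s i → ∑ (tuples vs (suc s)) (λ v → clique v * degree (removeAt v i)) ≡
                        ∑ (tuples vs s) (λ v → clique v * degree v ^ 2)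
    ∑-degree² s i = begin
      ∑ (tuples vs (suc s)) (λ v → clique v * degree (removeAt v i))
        ≡⟨ ∑-insertAt vs s i _ ⟩
      ∑ (tuples vs s) (λ v → ∑ vs (λ y → clique (insertAt v i y) * degree (removeAt (insertAt v i y) i)))
        ≡⟨ ∑-cong (tuples vs s) (λ v → trans (∑-cong vs (λ y →
             cong₂ (λ c z → c * degree z) (clique-insertAt v i y) (removeAt-insertAt v i y))) (collect v)) ⟩
      ∑ (tuples vs s) (λ v → clique v * degree v ^ 2) ∎
      where
      open ≡-Reasoning
      eq : ∀ c d → (d * c) * d ≡ c * (d * (d * 1))
      eq = solve-∀
      collect : ∀ v → ∑ vs (λ y → (∏ v (E y) * clique v) * degree v) ≡ clique v * degree v ^ 2
      collect v = trans (∑-*ʳ vs _ (degree v))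
        (trans (cong (_* degree v) (∑-*ʳ vs _ (clique v))) (eq (clique v) (degree v)))

    -- Let `Q` be the sum of the squared degrees over the `s`-cliques. Cauchy-Schwarz, which is
    -- `chebyshev` with exponent 1 and weight `clique`, bounds the square of `#cliques (suc s)` by
    -- `#cliques s * Q`. By `∑-degree²`, `suc s * Q` sums `degree (removeAt v i)` over all
    -- `suc s`-cliques `v` and positions `i`; for fixed `v`, `∑-∏-removeAt` bounds the contribution
    -- of a vertex `y` by 1, plus `s` if `y` is adjacent to all of `v`.
    moon-moser : ∀ s → suc s * (#cliques (suc s) * #cliques (suc s)) ≤
                       #cliques s * (N * #cliques (suc s) + s * #cliques (suc (suc s)))
    moon-moser s = begin
      suc s * (#cliques (suc s) * #cliques (suc s))    ≤⟨ *-monoʳ-≤ (suc s) cauchy-schwarz ⟩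
      suc s * (#cliques s * Q)                         ≡⟨ *-leftComm (suc s) (#cliques s) Q ⟩
      #cliques s * (suc s * Q)                         ≤⟨ *-monoʳ-≤ (#cliques s) count ⟩
      #cliques s * (N * #cliques (suc s) + s * #cliques (suc (suc s))) ∎
      where
      open ≤-Reasoning
      Q = ∑ (tuples vs s) (λ v → clique v * degree v ^ 2)
      Is = allFin (suc s)
      cauchy-schwarz : #cliques (suc s) * #cliques (suc s) ≤ #cliques s * Q
      cauchy-schwarz = begin
        #cliques (suc s) * #cliques (suc s)
          ≡⟨ cong₂ _*_ (#cliques-suc s) (trans (#cliques-suc s)
               (∑-cong (tuples vs s) (λ v → cong (clique v *_) (sym (*-identityʳ (degree v)))))) ⟩
        ∑ (tuples vs s) (λ v → clique v * degree v) * ∑ (tuples vs s) (λ v → clique v * degree v ^ 1)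
          ≤⟨ chebyshev (tuples vs s) 1 clique degree ⟩
        #cliques s * Q ∎
      pointwise : ∀ v → clique v * ∑ Is (λ i → degree (removeAt v i)) ≤ N * clique v + s * (clique v * degree v)
      pointwise v = begin
        clique v * ∑ Is (λ i → degree (removeAt v i))                     ≡⟨ cong (clique v *_) (∑-swap Is vs _) ⟩
        clique v * ∑ vs (λ y → ∑ Is (λ i → ∏ (removeAt v i) (E y)))       ≤⟨ *-monoʳ-≤ (clique v) (∑-mono vs (λ y → ∑-∏-removeAt s v (E≤1 y))) ⟩
        clique v * ∑ vs (λ y → 1 + s * ∏ v (E y))                         ≡⟨ cong (clique v *_) (trans (∑-+ vs _ _) (cong₂ _+_ (sym (length-∑ vs)) (∑-*ˡ vs s _))) ⟩
        clique v * (N + s * degree v)                                     ≡⟨ eq (clique v) N s (degree v) ⟩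
        N * clique v + s * (clique v * degree v)                          ∎
        where
        eq : ∀ c N s d → c * (N + s * d) ≡ N * c + s * (c * d)
        eq = solve-∀
      count : suc s * Q ≤ N * #cliques (suc s) + s * #cliques (suc (suc s))
      count = begin
        suc s * Q                                                                              ≡⟨ cong (_* Q) (sym (length-tabulate {n = suc s} id)) ⟩
        length Is * Q                                                                          ≡⟨ sym (∑-const Is Q) ⟩
        ∑ Is (λ _ → Q)                                                                         ≡⟨ ∑-cong Is (λ i → sym (∑-degree² s i)) ⟩
        ∑ Is (λ i → ∑ (tuples vs (suc s)) (λ v → clique v * degree (removeAt v i)))            ≡⟨ ∑-swap Is (tuples vs (suc s)) _ ⟩
        ∑ (tuples vs (suc s)) (λ v → ∑ Is (λ i → clique v * degree (removeAt v i)))            ≡⟨ ∑-cong (tuples vs (suc s)) (λ v → ∑-*ˡ Is (clique v) _) ⟩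
        ∑ (tuples vs (suc s)) (λ v → clique v * ∑ Is (λ i → degree (removeAt v i)))            ≤⟨ ∑-mono (tuples vs (suc s)) pointwise ⟩
        ∑ (tuples vs (suc s)) (λ v → N * clique v + s * (clique v * degree v))                 ≡⟨ ∑-+ (tuples vs (suc s)) _ _ ⟩
        ∑ (tuples vs (suc s)) (λ v → N * clique v) + ∑ (tuples vs (suc s)) (λ v → s * (clique v * degree v))
          ≡⟨ cong₂ _+_ (∑-*ˡ (tuples vs (suc s)) N _) (trans (∑-*ˡ (tuples vs (suc s)) s _) (cong (s *_) (sym (#cliques-suc (suc s))))) ⟩
        N * #cliques (suc s) + s * #cliques (suc (suc s)) ∎

    #cliques-suc-≤ : ∀ s → #cliques (suc s) ≤ N * #cliques s
    #cliques-suc-≤ s = begin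
      #cliques (suc s)                                        ≡⟨ ∑-tuples vs s clique ⟩
      ∑ vs (λ x → ∑ (tuples vs s) (λ v → clique (x ∷ v)))     ≤⟨ ∑-mono vs (λ x → ∑-mono (tuples vs s) (λ v → *-monoˡ-≤ (clique v) (∏-≤1 v (E≤1 x)))) ⟩
      ∑ vs (λ x → ∑ (tuples vs s) (λ v → 1 * clique v))       ≡⟨ ∑-const vs _ ⟩
      N * ∑ (tuples vs s) (λ v → 1 * clique v)                ≡⟨ cong (N *_) (∑-cong (tuples vs s) (λ v → *-identityˡ (clique v))) ⟩
      N * #cliques s                                          ∎
      where open ≤-Reasoning

    -- From edge density to clique density

    module _ (β b : ℕ) (dense : β * (N * #cliques 1) ≤ β * #cliques 2 + b * (N * #cliques 1)) where

      -- With q_s = #cliques (s+1) / (N #cliques s): if 1 - q_1 ≤ b/β then 1 - q_{s+1} ≤ (s+1) b/β.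
      clique-ratio : ∀ s → β * (N * #cliques (suc s)) ≤
                           β * #cliques (suc (suc s)) + suc s * (b * (N * #cliques (suc s)))
      clique-ratio zero    = ≤-trans dense (≤-reflexive (cong (β * #cliques 2 +_) (sym (*-identityˡ _))))
      clique-ratio (suc s) = step (#cliques (suc s)) (#cliques (suc (suc s))) (#cliques (suc (suc (suc s))))
        (clique-ratio s) (moon-moser (suc s)) (#cliques-suc-≤ (suc s))
        where
        e₁ : ∀ s a c N β → (a * suc s) * (β * (N * c)) + β * (a * (N * c)) ≡ (suc (suc s) * c) * (β * (N * a))
        e₁ = solve-∀
        e₂ : ∀ s a c N β b → (suc (suc s) * c) * (β * c + suc s * (b * (N * a))) ≡
             β * (suc (suc s) * (c * c)) + (suc (suc s) * c) * (suc s * (b * (N * a)))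
        e₂ = solve-∀
        e₃ : ∀ s a c e N β b → β * (a * (N * c + suc s * e)) + (suc (suc s) * c) * (suc s * (b * (N * a))) ≡
             (a * suc s) * (β * e + suc (suc s) * (b * (N * c))) + β * (a * (N * c))
        e₃ = solve-∀
        open ≤-Reasoning
        step : ∀ a c e → β * (N * a) ≤ β * c + suc s * (b * (N * a)) →
               suc (suc s) * (c * c) ≤ a * (N * c + suc s * e) → c ≤ N * a →
               β * (N * c) ≤ β * e + suc (suc s) * (b * (N * c))
        -- If there are no `suc s`-cliques, `a` cannot be cancelled, but then `c` vanishes too.
        step zero c e _ _ c≤0 = ≤-trans (≤-reflexive (trans (cong (λ c → β * (N * c)) c≡0)
            (trans (cong (β *_) (*-zeroʳ N)) (*-zeroʳ β)))) z≤n
          where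
          c≡0 : c ≡ 0
          c≡0 = n≤0⇒n≡0 (≤-trans c≤0 (≤-reflexive (*-zeroʳ N)))
        -- Adding `β * (a * (N * c))` to both sides raises the coefficient `suc s` to `suc (suc s)`,
        -- so that the induction hypothesis applies on the left; `mm` then replaces
        -- `suc (suc s) * (c * c)`, and the added term cancels.
        step a@(suc _) c e ih mm _ = *-cancelˡ-≤ (a * suc s) (+-cancelʳ-≤ (β * (a * (N * c))) _ _ (begin
          (a * suc s) * (β * (N * c)) + β * (a * (N * c))                               ≡⟨ e₁ s a c N β ⟩
          (suc (suc s) * c) * (β * (N * a))                                             ≤⟨ *-monoʳ-≤ (suc (suc s) * c) ih ⟩
          (suc (suc s) * c) * (β * c + suc s * (b * (N * a)))                           ≡⟨ e₂ s a c N β b ⟩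
          β * (suc (suc s) * (c * c)) + (suc (suc s) * c) * (suc s * (b * (N * a)))     ≤⟨ +-monoˡ-≤ _ (*-monoʳ-≤ β mm) ⟩
          β * (a * (N * c + suc s * e)) + (suc (suc s) * c) * (suc s * (b * (N * a)))   ≡⟨ e₃ s a c e N β b ⟩
          (a * suc s) * (β * e + suc (suc s) * (b * (N * c))) + β * (a * (N * c))       ∎))

    -- With `β` equal to `suc b * e`, `clique-ratio` bounds 1 - q_s by s/e times `b / suc b`, hence
    -- by `b / suc b` as long as s is at most `e`. So each of these steps multiplies the clique
    -- count by at least `N / suc b`.
    many-cliques : ∀ e .{{_ : NonZero e}} b →
                   (suc b * e) * (N * #cliques 1) ≤ (suc b * e) * #cliques 2 + b * (N * #cliques 1) →
                   ∀ s → s ≤ e → N ^ suc s ≤ suc b ^ s * #cliques (suc s)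
    many-cliques e b dense zero    _   = ≤-reflexive (begin
      N * 1                                 ≡⟨ sym (∑-const vs 1) ⟩
      ∑ vs (λ _ → 1)                        ≡⟨ sym (∑-tuples vs 0 clique) ⟩
      #cliques 1                            ≡⟨ sym (*-identityˡ _) ⟩
      1 * #cliques 1                        ∎)
      where open ≡-Reasoning
    many-cliques e b dense (suc s) s<e = begin
      N * N ^ suc s                         ≤⟨ *-monoʳ-≤ N (many-cliques e b dense s (<⇒≤ s<e)) ⟩
      N * (suc b ^ s * c)                   ≡⟨ *-leftComm N (suc b ^ s) c ⟩
      suc b ^ s * (N * c)                   ≤⟨ *-monoʳ-≤ (suc b ^ s) ratio ⟩
      suc b ^ s * (suc b * c′)              ≡⟨ eq (suc b ^ s) (suc b) c′ ⟩
      suc b ^ suc s * c′                    ∎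
      where
      open ≤-Reasoning
      c  = #cliques (suc s)
      c′ = #cliques (suc (suc s))
      eq : ∀ p b c → p * (b * c) ≡ (b * p) * c
      eq = solve-∀
      e₁ : ∀ e b x → e * x + e * (b * x) ≡ (suc b * e) * x
      e₁ = solve-∀
      e₂ : ∀ e b x → (suc b * e) * x ≡ e * (suc b * x)
      e₂ = solve-∀
      ratio : N * c ≤ suc b * c′
      ratio = *-cancelˡ-≤ e (+-cancelʳ-≤ (e * (b * (N * c))) _ _ (begin
        e * (N * c) + e * (b * (N * c))                   ≡⟨ e₁ e b (N * c) ⟩
        (suc b * e) * (N * c)                             ≤⟨ clique-ratio (suc b * e) b dense s ⟩
        (suc b * e) * c′ + suc s * (b * (N * c))          ≤⟨ +-monoʳ-≤ _ (*-monoˡ-≤ (b * (N * c)) s<e) ⟩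
        (suc b * e) * c′ + e * (b * (N * c))              ≡⟨ cong (_+ e * (b * (N * c))) (e₂ e b c′) ⟩
        e * (suc b * c′) + e * (b * (N * c))              ∎))

  -- Blow-ups: complete multipartite configurations

  -- The product of F over all transversals of the rows of X.
  blowup : ∀ {t r} → (Vec A r → ℕ) → Vec (Vec A t) r → ℕ
  blowup F []        = F []
  blowup F (row ∷ X) = blowup (λ v → ∏ row (λ x → F (x ∷ v))) X

  blowup-≤1 : ∀ {t r} (F : Vec A r → ℕ) → (∀ v → F v ≤ 1) → (X : Vec (Vec A t) r) → blowup F X ≤ 1
  blowup-≤1 F F≤1 []        = F≤1 []
  blowup-≤1 F F≤1 (row ∷ X) = blowup-≤1 _ (λ v → ∏-≤1 row (λ x → F≤1 (x ∷ v))) X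

  ∏-factor : ∀ {t} (v : Vec A t) f i → 0 < ∏ v f → 0 < f (lookup v i)
  ∏-factor (x ∷ v) f zero    pos = >-nonZero⁻¹ (f x) {{m*n≢0⇒m≢0 (f x) {{>-nonZero pos}}}}
  ∏-factor (x ∷ v) f (suc i) pos = ∏-factor v f i (>-nonZero⁻¹ (∏ v f) {{m*n≢0⇒n≢0 (f x) {{>-nonZero pos}}}})

  blowup-factor : ∀ {t r} (F : Vec A r → ℕ) (X : Vec (Vec A t) r) (φ : Vec (Fin t) r) →
                  0 < blowup F X → 0 < F (zipWith lookup X φ)
  blowup-factor F []        []      pos = pos
  blowup-factor F (row ∷ X) (i ∷ φ) pos = ∏-factor row _ i (blowup-factor _ X φ pos)

  ^-distribʳ-* : ∀ m n t → (m * n) ^ t ≡ m ^ t * n ^ t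
  ^-distribʳ-* m n zero    = refl
  ^-distribʳ-* m n (suc t) = trans (cong (m * n *_) (^-distribʳ-* m n t)) (eq m n (m ^ t) (n ^ t))
    where
    eq : ∀ a b c d → (a * b) * (c * d) ≡ (a * c) * (b * d)
    eq = solve-∀

  -- Convexity, one part at a time; `a / D` is a lower bound for the density of `F`. A power mean
  -- with exponent `t` over the last `r` coordinates bounds the mean of `G`, the total of `F` blown
  -- up in the first part only. The induction hypothesis for each `row`, combined with a power mean
  -- over rows with exponent `t ^ r`, blows up the other parts.
  blowup-dense : ∀ (xs : List A) .{{_ : NonZero (length xs)}} t r (F : Vec A r → ℕ) a D →
                 length xs ^ r * a ≤ D * ∑ (tuples xs r) F →
                 (length xs ^ t) ^ r * a ^ (t ^ r) ≤
                 D ^ (t ^ r) * ∑ (tuples (tuples xs t) r) (blowup F)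
  blowup-dense xs t zero    F a D le = ≤-trans (≤-reflexive (e a)) (≤-trans le (≤-reflexive (e′ D (F []))))
    where
    e : ∀ a → 1 * (a * 1) ≡ 1 * a
    e = solve-∀
    e′ : ∀ D x → D * (x + 0) ≡ (D * 1) * (x + 0)
    e′ = solve-∀
  blowup-dense {A = A} xs t (suc r) F a D le = *-cancelˡ-≤ ((N ^ r) ^ T) {{m^n≢0 (N ^ r) T {{m^n≢0 N r}}}} (begin
    (N ^ r) ^ T * ((N ^ t * (N ^ t) ^ r) * a ^ (t * T))
      ≡⟨ cong (λ z → (N ^ r) ^ T * ((N ^ t * (N ^ t) ^ r) * z)) (sym (^-*-assoc a t T)) ⟩
    (N ^ r) ^ T * ((N ^ t * (N ^ t) ^ r) * (a ^ t) ^ T)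
      ≡⟨ e₁ ((N ^ r) ^ T) (N ^ t) ((N ^ t) ^ r) ((a ^ t) ^ T) ⟩
    (N ^ t) ^ r * (N ^ t * ((N ^ r) ^ T * (a ^ t) ^ T))
      ≡⟨ cong (λ z → (N ^ t) ^ r * (N ^ t * z)) (sym (^-distribʳ-* (N ^ r) (a ^ t) T)) ⟩
    (N ^ t) ^ r * (N ^ t * (N ^ r * a ^ t) ^ T)
      ≤⟨ *-monoʳ-≤ ((N ^ t) ^ r) rows-mean ⟩
    (N ^ t) ^ r * (D ^ (t * T) * ∑ Rows (λ row → G row ^ T))
      ≡⟨ *-leftComm ((N ^ t) ^ r) (D ^ (t * T)) _ ⟩
    D ^ (t * T) * ((N ^ t) ^ r * ∑ Rows (λ row → G row ^ T))
      ≤⟨ *-monoʳ-≤ (D ^ (t * T)) rows-IH ⟩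
    D ^ (t * T) * ((N ^ r) ^ T * ∑ (tuples Rows (suc r)) (blowup F))
      ≡⟨ *-leftComm (D ^ (t * T)) ((N ^ r) ^ T) _ ⟩
    (N ^ r) ^ T * (D ^ (t * T) * ∑ (tuples Rows (suc r)) (blowup F)) ∎)
    where
    open ≤-Reasoning
    N    = length xs
    T    = t ^ r
    Rows = tuples xs t
    F′ : Vec A t → Vec A r → ℕ
    F′ row v = ∏ row (λ x → F (x ∷ v))
    G : Vec A t → ℕ
    G row = ∑ (tuples xs r) (F′ row)
    e₁ : ∀ p q s z → p * ((q * s) * z) ≡ s * (q * (p * z))
    e₁ = solve-∀
    e₂ : ∀ m n a → (m * n) * a ≡ n * (m * a)
    e₂ = solve-∀
    columns-mean : N ^ t * (N ^ r * a ^ t) ≤ D ^ t * ∑ Rows G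
    columns-mean = begin
      N ^ t * (N ^ r * a ^ t)                                        ≡⟨ *-leftComm (N ^ t) (N ^ r) (a ^ t) ⟩
      N ^ r * (N ^ t * a ^ t)                                        ≡⟨ cong₂ _*_ (sym (length-tuples xs r)) (sym (^-distribʳ-* N a t)) ⟩
      length (tuples xs r) * (N * a) ^ t                             ≤⟨ power-mean (tuples xs r) t _ D (N * a) le′ ⟩
      D ^ t * ∑ (tuples xs r) (λ v → ∑ xs (λ x → F (x ∷ v)) ^ t)     ≡⟨ cong (D ^ t *_) (trans (∑-cong (tuples xs r) (λ v → ∑-^ xs t _)) (∑-swap (tuples xs r) Rows _)) ⟩
      D ^ t * ∑ Rows G                                               ∎
      where
      le′ : length (tuples xs r) * (N * a) ≤ D * ∑ (tuples xs r) (λ v → ∑ xs (λ x → F (x ∷ v)))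
      le′ = begin
        length (tuples xs r) * (N * a)                               ≡⟨ cong (_* (N * a)) (length-tuples xs r) ⟩
        N ^ r * (N * a)                                              ≡⟨ sym (e₂ N (N ^ r) a) ⟩
        N ^ suc r * a                                                ≤⟨ le ⟩
        D * ∑ (tuples xs (suc r)) F                                  ≡⟨ cong (D *_) (∑-insertAt xs r zero F) ⟩
        D * ∑ (tuples xs r) (λ v → ∑ xs (λ x → F (x ∷ v)))           ∎
    rows-mean : N ^ t * (N ^ r * a ^ t) ^ T ≤ D ^ (t * T) * ∑ Rows (λ row → G row ^ T)
    rows-mean = begin
      N ^ t * (N ^ r * a ^ t) ^ T                        ≡⟨ cong (_* (N ^ r * a ^ t) ^ T) (sym (length-tuples xs t)) ⟩
      length Rows * (N ^ r * a ^ t) ^ T                  ≤⟨ power-mean Rows T G (D ^ t) (N ^ r * a ^ t)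
                                                              (≤-trans (≤-reflexive (cong (_* (N ^ r * a ^ t)) (length-tuples xs t))) columns-mean) ⟩
      (D ^ t) ^ T * ∑ Rows (λ row → G row ^ T)           ≡⟨ cong (_* ∑ Rows (λ row → G row ^ T)) (^-*-assoc D t T) ⟩
      D ^ (t * T) * ∑ Rows (λ row → G row ^ T)           ∎
    rows-IH : (N ^ t) ^ r * ∑ Rows (λ row → G row ^ T) ≤ (N ^ r) ^ T * ∑ (tuples Rows (suc r)) (blowup F)
    rows-IH = begin
      (N ^ t) ^ r * ∑ Rows (λ row → G row ^ T)                                  ≡⟨ sym (∑-*ˡ Rows ((N ^ t) ^ r) _) ⟩
      -- The density of `F′ row` is exactly `G row` over `N ^ r`, so the hypothesis is reflexivity;
      -- the resulting factor `(N ^ r) ^ T` is the one cancelled outside.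
      ∑ Rows (λ row → (N ^ t) ^ r * G row ^ T)                                  ≤⟨ ∑-mono Rows (λ row → blowup-dense xs t r (F′ row) (G row) (N ^ r) ≤-refl) ⟩
      ∑ Rows (λ row → (N ^ r) ^ T * ∑ (tuples Rows r) (blowup (F′ row)))        ≡⟨ ∑-*ˡ Rows ((N ^ r) ^ T) _ ⟩
      (N ^ r) ^ T * ∑ Rows (λ row → ∑ (tuples Rows r) (blowup (F′ row)))        ≡⟨ cong ((N ^ r) ^ T *_) (sym (∑-tuples Rows r (blowup F))) ⟩
      (N ^ r) ^ T * ∑ (tuples Rows (suc r)) (blowup F)                          ∎

  -- Averaging by resampling one entry

  -- Tuples that differ only at `q` form lines of `length xs` members, and `F` adds up to at most
  -- `K` on each line.
  ∑-resample-≤ : ∀ (xs : List A) s (q : Fin s) (F : Vec A s → ℕ) K →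
                 (∀ v → ∑ xs (λ y → F (v [ q ]≔ y)) ≤ K) →
                 length xs * ∑ (tuples xs s) F ≤ K * length xs ^ s
  ∑-resample-≤ []         (suc s) q F K bound = z≤n
  ∑-resample-≤ xs@(x ∷ _) (suc s) zero F K bound = begin
    N * ∑ (tuples xs (suc s)) F                                  ≡⟨ cong (N *_) (∑-insertAt xs s zero F) ⟩
    -- The head `x` is a placeholder that the update overwrites; the list is nonempty, so one
    -- exists.
    N * ∑ (tuples xs s) (λ v → ∑ xs (λ y → F (y ∷ v)))           ≤⟨ *-monoʳ-≤ N (∑-mono (tuples xs s) (λ v → bound (x ∷ v))) ⟩
    N * ∑ (tuples xs s) (λ _ → K)                                ≡⟨ cong (N *_) (trans (∑-const (tuples xs s) K) (cong (_* K) (length-tuples xs s))) ⟩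
    N * (N ^ s * K)                                              ≡⟨ eq N (N ^ s) K ⟩
    K * N ^ suc s                                                ∎
    where
    open ≤-Reasoning
    N = length xs
    eq : ∀ n m k → n * (m * k) ≡ k * (n * m)
    eq = solve-∀
  ∑-resample-≤ xs@(_ ∷ _) (suc s) (suc q) F K bound = begin
    N * ∑ (tuples xs (suc s)) F                                  ≡⟨ cong (N *_) (∑-tuples xs s F) ⟩
    N * ∑ xs (λ x → ∑ (tuples xs s) (λ v → F (x ∷ v)))           ≡⟨ sym (∑-*ˡ xs N _) ⟩
    ∑ xs (λ x → N * ∑ (tuples xs s) (λ v → F (x ∷ v)))           ≤⟨ ∑-mono xs (λ x → ∑-resample-≤ xs s q _ K (λ v → bound (x ∷ v))) ⟩
    ∑ xs (λ x → K * N ^ s)                                       ≡⟨ ∑-const xs _ ⟩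
    N * (K * N ^ s)                                              ≡⟨ *-leftComm N K (N ^ s) ⟩
    K * N ^ suc s                                                ∎
    where
    open ≤-Reasoning
    N = length xs

  -- `∑-resample-≤` is used at `q` within a row and at `p` on the tuple of rows; the latter brings
  -- in the factor `N ^ t`, the number of possible rows, which is cancelled.
  ∑-resample²-≤ : ∀ (xs : List A) .{{_ : NonZero (length xs)}} t r (p : Fin r) (q : Fin t) (F : Vec (Vec A t) r → ℕ) K →
                  (∀ X row → ∑ xs (λ y → F (X [ p ]≔ (row [ q ]≔ y))) ≤ K) →
                  length xs * ∑ (tuples (tuples xs t) r) F ≤ K * (length xs ^ t) ^ r
  ∑-resample²-≤ xs t r p q F K bound = *-cancelˡ-≤ (N ^ t) {{m^n≢0 N t}} (begin
    N ^ t * (N * ∑ (tuples Rows r) F)                ≡⟨ cong₂ _*_ (sym (length-tuples xs t)) (sym (∑-*ˡ (tuples Rows r) N F)) ⟩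
    length Rows * ∑ (tuples Rows r) (λ X → N * F X)  ≤⟨ ∑-resample-≤ Rows r p (λ X → N * F X) (K * N ^ t) (λ X →
                                                          ≤-trans (≤-reflexive (∑-*ˡ Rows N _)) (∑-resample-≤ xs t q _ K (bound X))) ⟩
    (K * N ^ t) * length Rows ^ r                    ≡⟨ cong (λ l → (K * N ^ t) * l ^ r) (length-tuples xs t) ⟩
    (K * N ^ t) * (N ^ t) ^ r                        ≡⟨ eq K (N ^ t) ((N ^ t) ^ r) ⟩
    N ^ t * (K * (N ^ t) ^ r)                        ∎)
    where
    open ≤-Reasoning
    N    = length xs
    Rows = tuples xs t
    eq : ∀ k m l → (k * m) * l ≡ m * (k * l)
    eq = solve-∀

  -- Indicators and lookups

  𝟙 : Bool → ℕ
  𝟙 true  = 1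
  𝟙 false = 0

  𝟙-≤1 : ∀ b → 𝟙 b ≤ 1
  𝟙-≤1 true  = ≤-refl
  𝟙-≤1 false = z≤n

  ∑-𝟙-lookup : ∀ {n} (p : Subset n) → ∑ (allFin n) (λ z → 𝟙 (lookup p z)) ≡ ∣ p ∣
  ∑-𝟙-lookup []          = refl
  ∑-𝟙-lookup (true  ∷ p) = trans (∑-allFin _ (λ z → 𝟙 (lookup (true ∷ p) z))) (cong suc (∑-𝟙-lookup p))
  ∑-𝟙-lookup (false ∷ p) = trans (∑-allFin _ (λ z → 𝟙 (lookup (false ∷ p) z))) (∑-𝟙-lookup p)

  𝟙-lookup-∉ : ∀ {n} (p : Subset n) z → 𝟙 (lookup p z) ≡ 0 → z ∉ p
  𝟙-lookup-∉ p z eq z∈p = contradiction (trans (sym eq) (cong 𝟙 ([]=⇒lookup z∈p))) λ ()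

  term≤∑-allFin : ∀ n (f : Fin n → ℕ) i → f i ≤ ∑ (allFin n) f
  term≤∑-allFin (suc n) f zero    = m≤m+n (f zero) _
  term≤∑-allFin (suc n) f (suc i) =
    ≤-trans (≤-trans (term≤∑-allFin n (λ i → f (suc i)) i) (m≤n+m _ (f zero))) (≤-reflexive (sym (∑-allFin n f)))

  term≤∑-tuples : ∀ n s (F : Vec (Fin n) s → ℕ) v → F v ≤ ∑ (tuples (allFin n) s) F
  term≤∑-tuples n zero    F []      = m≤m+n (F []) 0
  term≤∑-tuples n (suc s) F (x ∷ v) = begin
    F (x ∷ v)                                                        ≤⟨ term≤∑-tuples n s (λ v → F (x ∷ v)) v ⟩
    ∑ (tuples (allFin n) s) (λ v → F (x ∷ v))                        ≤⟨ term≤∑-allFin n _ x ⟩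
    ∑ (allFin n) (λ x → ∑ (tuples (allFin n) s) (λ v → F (x ∷ v)))   ≡⟨ sym (∑-tuples (allFin n) s F) ⟩
    ∑ (tuples (allFin n) (suc s)) F                                  ∎
    where open ≤-Reasoning

  -- Only column `q` changes, so an entry in another column survives even in the resampled row.
  lookup-resample : ∀ {t r} (X : Vec (Vec A t) r) row p q y p′ {q′} → q′ ≢ q →
                    lookup (lookup (X [ p ]≔ (row [ q ]≔ y)) p′) q′ ≡ lookup (lookup (X [ p ]≔ row) p′) q′
  lookup-resample X row p q y p′ {q′} q′≢q with p′ ≟ p
  ... | yes refl = begin
    lookup (lookup (X [ p ]≔ (row [ q ]≔ y)) p) q′  ≡⟨ cong (λ w → lookup w q′) (lookup∘update p X _) ⟩
    lookup (row [ q ]≔ y) q′                        ≡⟨ lookup∘update′ q′≢q row y ⟩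
    lookup row q′                                   ≡⟨ cong (λ w → lookup w q′) (sym (lookup∘update p X row)) ⟩
    lookup (lookup (X [ p ]≔ row) p) q′             ∎
    where open ≡-Reasoning
  ... | no p′≢p = cong (λ w → lookup w q′)
    (trans (lookup∘update′ p′≢p X _) (sym (lookup∘update′ p′≢p X _)))

  Unique⇒lookup-injective : ∀ {xs : List A} → Unique xs → ∀ i j → L.lookup xs i ≡ L.lookup xs j → i ≡ j
  Unique⇒lookup-injective (_   ∷ _)  zero    zero    eq = refl
  Unique⇒lookup-injective (x∉ ∷ _)   zero    (suc j) eq = contradiction eq (All.lookup x∉ (∈-lookup j))
  Unique⇒lookup-injective (x∉ ∷ _)   (suc i) zero    eq = contradiction (sym eq) (All.lookup x∉ (∈-lookup i))
  Unique⇒lookup-injective (_   ∷ un) (suc i) (suc j) eq = cong suc (Unique⇒lookup-injective un i j eq)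

  -- The shadow graph and its chosen hyperedges

  module Shadow {k n} (H : KGraph k n) where

    hs = hedges H

    Covers : Fin n → Fin n → Fin (length hs) → Set
    Covers x y j = x ∈ L.lookup hs j × y ∈ L.lookup hs j

    covered? : ∀ x y → Dec (∃ (Covers x y))
    covered? x y = any? (λ j → (x ∈? L.lookup hs j) ×-dec (y ∈? L.lookup hs j))

    -- Adjacency in the shadow, with a loop at every vertex that lies in a hyperedge.
    E : Fin n → Fin n → ℕ
    E x y = 𝟙 (does (covered? x y))

    E-sym : ∀ x y → E x y ≡ E y x
    E-sym x y = cong 𝟙 (does-⇔ (mk⇔ swap swap) (covered? x y) (covered? y x))
      where
      swap : ∀ {x y} → ∃ (Covers x y) → ∃ (Covers y x)
      swap (j , x∈ , y∈) = j , y∈ , x∈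

    E≤1 : ∀ x y → E x y ≤ 1
    E≤1 x y = 𝟙-≤1 _

    -- The default `⊥` respects the size bound, and `E>0⇒chosenEdge` rules it out for adjacent
    -- pairs.
    chosenEdge : Fin n → Fin n → Subset n
    chosenEdge x y with covered? x y
    ... | yes (j , _) = L.lookup hs j
    ... | no  _       = ⊥

    ∣chosenEdge∣≤k : ∀ x y → ∣ chosenEdge x y ∣ ≤ k
    ∣chosenEdge∣≤k x y with covered? x y
    ... | yes (j , _) = ≤-reflexive (All.lookup (uniformE H) (∈-lookup j))
    ... | no  _       = ≤-trans (≤-reflexive (∣⊥∣≡0 n)) z≤n

    E>0⇒chosenEdge : ∀ x y → 0 < E x y → ∃ λ j → Covers x y j × chosenEdge x y ≡ L.lookup hs j
    E>0⇒chosenEdge x y pos with covered? x y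
    ... | yes (j , cov) = j , cov , refl

    -- Counts the ways in which `z` spoils a placement using `x` and `y`: lying in their chosen
    -- hyperedge, or coinciding with `x`.
    conflict : Fin n → Fin n → Fin n → ℕ
    conflict x y z = 𝟙 (lookup (chosenEdge x y) z) + 𝟙 (lookup ⁅ x ⁆ z)

    ∑-conflict-≤ : ∀ x y → ∑ (allFin n) (conflict x y) ≤ suc k
    ∑-conflict-≤ x y = begin
      ∑ (allFin n) (conflict x y)      ≡⟨ ∑-+ (allFin n) _ _ ⟩
      ∑ (allFin n) (λ z → 𝟙 (lookup (chosenEdge x y) z)) + ∑ (allFin n) (λ z → 𝟙 (lookup ⁅ x ⁆ z))
                                       ≡⟨ cong₂ _+_ (∑-𝟙-lookup (chosenEdge x y)) (trans (∑-𝟙-lookup ⁅ x ⁆) (∣⁅x⁆∣≡1 x)) ⟩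
      ∣ chosenEdge x y ∣ + 1           ≤⟨ +-monoˡ-≤ 1 (∣chosenEdge∣≤k x y) ⟩
      k + 1                            ≡⟨ +-comm k 1 ⟩
      suc k                            ∎
      where open ≤-Reasoning

    open Cliques (allFin n) E E-sym E≤1 public

    clique⇒E>0 : ∀ {s} (v : Vec (Fin n) s) i j → i ≢ j → 0 < clique v → 0 < E (lookup v i) (lookup v j)
    clique⇒E>0 (x ∷ v) zero    zero    i≢j pos = contradiction refl i≢j
    clique⇒E>0 (x ∷ v) zero    (suc j) i≢j pos =
      ∏-factor v (E x) j (>-nonZero⁻¹ _ {{m*n≢0⇒m≢0 (∏ v (E x)) {{>-nonZero pos}}}})
    clique⇒E>0 (x ∷ v) (suc i) zero    i≢j pos =
      subst (0 <_) (E-sym x (lookup v i))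
        (∏-factor v (E x) i (>-nonZero⁻¹ _ {{m*n≢0⇒m≢0 (∏ v (E x)) {{>-nonZero pos}}}}))
    clique⇒E>0 (x ∷ v) (suc i) (suc j) i≢j pos =
      clique⇒E>0 v i j (λ i≡j → i≢j (cong suc i≡j))
        (>-nonZero⁻¹ _ {{m*n≢0⇒n≢0 (∏ v (E x)) {{>-nonZero pos}}}})

    -- Berge copies from configurations without conflicts

    module Embedding {m r} (G : SimpleGraph m) (colorable : Colorable G r) where

      col = proj₁ colorable

      -- Every part has `m` slots, and `u` takes slot `u` of the part of its colour. Distinct
      -- vertices read distinct columns, so changing one entry moves at most one image.
      image : Vec (Vec (Fin n) m) r → Fin m → Fin n
      image X u = lookup (lookup X (col u)) u

      distinct? : (a b c : Fin m) → Dec (c ≢ a × c ≢ b)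
      distinct? a b c = ¬? (c ≟ a) ×-dec ¬? (c ≟ b)

      -- Only `c` has to differ from the other two: triples with `a` equal to `b` detect coinciding
      -- images.
      bad-at : Vec (Vec (Fin n) m) r → Vec (Fin m) 3 → ℕ
      bad-at X (a ∷ b ∷ c ∷ []) = 𝟙 (does (distinct? a b c)) * conflict (image X a) (image X b) (image X c)

      bad : Vec (Vec (Fin n) m) r → ℕ
      bad X = ∑ (tuples (allFin m) 3) (bad-at X)

      good : Vec (Vec (Fin n) m) r → ℕ
      good = blowup clique

      module _ (X : Vec (Vec (Fin n) m) r) (good>0 : 0 < good X) (bad≡0 : bad X ≡ 0) where

        i = image X

        no-conflict : ∀ a b c → c ≢ a → c ≢ b → conflict (i a) (i b) (i c) ≡ 0
        no-conflict a b c c≢a c≢b = begin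
          conflict (i a) (i b) (i c)            ≡⟨ sym (*-identityˡ _) ⟩
          1 * conflict (i a) (i b) (i c)        ≡⟨ cong (λ d → 𝟙 d * conflict (i a) (i b) (i c)) (sym (dec-true (distinct? a b c) (c≢a , c≢b))) ⟩
          bad-at X (a ∷ b ∷ c ∷ [])             ≡⟨ n≤0⇒n≡0 (≤-trans (term≤∑-tuples m 3 (bad-at X) (a ∷ b ∷ c ∷ [])) (≤-reflexive bad≡0)) ⟩
          0                                     ∎
          where open ≡-Reasoning

        i-injective : ∀ {a c} → i a ≡ i c → a ≡ c
        i-injective {a} {c} eq with c ≟ a
        ... | yes c≡a = sym c≡a
        ... | no  c≢a = contradiction (subst (_∈ ⁅ i a ⁆) eq (x∈⁅x⁆ (i a)))
          (𝟙-lookup-∉ ⁅ i a ⁆ (i c) (m+n≡0⇒n≡0 (𝟙 (lookup (chosenEdge (i a) (i a)) (i c))) (no-conflict a a c c≢a c≢a)))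

        chosenEdge-endpoints : ∀ a b c → i c ∈ chosenEdge (i a) (i b) → c ≡ a ⊎ c ≡ b
        chosenEdge-endpoints a b c i∈ with c ≟ a | c ≟ b
        ... | yes c≡a | _       = inj₁ c≡a
        ... | no  _   | yes c≡b = inj₂ c≡b
        ... | no  c≢a | no  c≢b = contradiction i∈
          (𝟙-lookup-∉ (chosenEdge (i a) (i b)) (i c) (m+n≡0⇒m≡0 _ (no-conflict a b c c≢a c≢b)))

        adjacent : ∀ u v → col u ≢ col v → 0 < E (i u) (i v)
        adjacent u v cu≢cv = subst (0 <_) (cong₂ E at-u at-v)
          (clique⇒E>0 (zipWith lookup X φ) (col u) (col v) cu≢cv (blowup-factor clique X φ good>0))
          where
          -- The transversal through column `u` in row `col u` and column `v` in all other rows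
          -- meets both images, since the colours differ.
          φ = replicate r v [ col u ]≔ u
          at-u : lookup (zipWith lookup X φ) (col u) ≡ i u
          at-u = trans (lookup-zipWith lookup (col u) X φ)
            (cong (lookup (lookup X (col u))) (lookup∘update (col u) (replicate r v) u))
          at-v : lookup (zipWith lookup X φ) (col v) ≡ i v
          at-v = trans (lookup-zipWith lookup (col v) X φ)
            (cong (lookup (lookup X (col v)))
              (trans (lookup∘update′ (λ eq → cu≢cv (sym eq)) (replicate r v) u) (lookup-replicate (col v) v)))

        src tgt : Fin (length (edges G)) → Fin m
        src j = proj₁ (L.lookup (edges G) j)
        tgt j = proj₂ (L.lookup (edges G) j)

        choice : ∀ j → ∃ λ h → Covers (i (src j)) (i (tgt j)) h × chosenEdge (i (src j)) (i (tgt j)) ≡ L.lookup hs h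
        choice j = E>0⇒chosenEdge _ _ (adjacent (src j) (tgt j) (All.lookup (proj₂ colorable) (∈-lookup j)))

        f : Fin (length (edges G)) → Fin (length hs)
        f j = proj₁ (choice j)

        -- If `f j` and `f j′` agree, the hyperedge chosen for `j` contains the images of both ends
        -- of `j′`, so by `chosenEdge-endpoints` these are ends of `j`. Edges are stored with the
        -- smaller end first, which excludes that both ends of `j′` are the same end of `j` or that
        -- they are swapped.
        f-injective : ∀ {j j′} → f j ≡ f j′ → j ≡ j′
        f-injective {j} {j′} eq = Unique⇒lookup-injective (unique G) j j′ (same-edge (endpoint (proj₁ (proj₁ (proj₂ (choice j′)))))
                                                                                      (endpoint (proj₂ (proj₁ (proj₂ (choice j′))))))
          where
          endpoint : ∀ {c} → i c ∈ L.lookup hs (f j′) → c ≡ src j ⊎ c ≡ tgt j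
          endpoint {c} i∈ = chosenEdge-endpoints (src j) (tgt j) c
            (subst (i c ∈_) (trans (cong (L.lookup hs) (sym eq)) (sym (proj₂ (proj₂ (choice j))))) i∈)
          src<tgt : ∀ j → toℕ (src j) < toℕ (tgt j)
          src<tgt j = All.lookup (ordered G) (∈-lookup j)
          same-edge : src j′ ≡ src j ⊎ src j′ ≡ tgt j → tgt j′ ≡ src j ⊎ tgt j′ ≡ tgt j →
                      L.lookup (edges G) j ≡ L.lookup (edges G) j′
          same-edge (inj₁ s) (inj₂ t) = cong₂ _,_ (sym s) (sym t)
          same-edge (inj₁ s) (inj₁ t) = contradiction (src<tgt j′) (<-irrefl (cong toℕ (trans s (sym t))))
          same-edge (inj₂ s) (inj₂ t) = contradiction (src<tgt j′) (<-irrefl (cong toℕ (trans s (sym t))))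
          same-edge (inj₂ s) (inj₁ t) = contradiction (src<tgt j) (<-asym
            (subst (λ w → toℕ w < toℕ (src j)) s (subst (λ w → toℕ (src j′) < toℕ w) t (src<tgt j′))))

        berge : ContainsBerge H G
        berge = i , f , i-injective , f-injective , λ j → proj₁ (proj₂ (choice j))

      -- If `good X` is positive and `bad X` is zero, `berge` gives a forbidden copy. Otherwise
      -- `good X` is zero or `bad X` is at least 1, and `good X` never exceeds 1.
      good≤bad : BergeFree H G → ∀ X → good X ≤ bad X
      good≤bad free X with good X in good≡ | bad X in bad≡
      ... | zero  | _     = z≤n
      ... | suc g | zero  = contradiction (berge X (subst (0 <_) (sym good≡) z<s) bad≡) free
      ... | suc g | suc b = ≤-trans (subst (_≤ 1) good≡ (blowup-≤1 clique clique-≤1 X)) (s≤s z≤n)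

      module _ .{{_ : NonZero N}} where

        Xs = tuples (tuples (allFin n) m) r

        -- Resampling the entry that holds the image of `c` leaves the images of `a` and `b` fixed,
        -- so `∑-conflict-≤` applies: at most `k` conflicts come from the hyperedge and one from the
        -- image of `a`.
        ∑-bad-at-≤ : ∀ abc → N * ∑ Xs (λ X → bad-at X abc) ≤ suc k * (N ^ m) ^ r
        ∑-bad-at-≤ (a ∷ b ∷ c ∷ []) =
          ∑-resample²-≤ (allFin n) m r (col c) c (λ X → bad-at X (a ∷ b ∷ c ∷ [])) (suc k) (λ X row → resampled X row (distinct? a b c))
          where
          open ≤-Reasoning
          resampled : ∀ X row (d : Dec (c ≢ a × c ≢ b)) → ∑ (allFin n) (λ y → let X′ = X [ col c ]≔ (row [ c ]≔ y) in
                        𝟙 (does d) * conflict (image X′ a) (image X′ b) (image X′ c)) ≤ suc k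
          resampled X row (no _) = ≤-trans (≤-reflexive (trans (∑-const (allFin n) 0) (*-zeroʳ N))) z≤n
          resampled X row (yes (c≢a , c≢b)) = begin
            ∑ (allFin n) (λ y → 1 * conflict (image (X′ y) a) (image (X′ y) b) (image (X′ y) c))
              ≡⟨ ∑-cong (allFin n) (λ y → trans (*-identityˡ _) (cong₃ conflict (at-other y c≢a) (at-other y c≢b) (at-c y))) ⟩
            ∑ (allFin n) (conflict (image X″ a) (image X″ b))
              ≤⟨ ∑-conflict-≤ _ _ ⟩
            suc k ∎
            where
            X′ = λ y → X [ col c ]≔ (row [ c ]≔ y)
            X″ = X [ col c ]≔ row
            cong₃ : ∀ (g : Fin n → Fin n → Fin n → ℕ) {x x′ y y′ z z′} → x ≡ x′ → y ≡ y′ → z ≡ z′ → g x y z ≡ g x′ y′ z′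
            cong₃ g refl refl refl = refl
            at-other : ∀ y {u} → c ≢ u → image (X′ y) u ≡ image X″ u
            at-other y {u} c≢u = lookup-resample X row (col c) c y (col u) (λ eq → c≢u (sym eq))
            at-c : ∀ y → image (X′ y) c ≡ y
            at-c y = trans (cong (λ w → lookup w c) (lookup∘update (col c) X _)) (lookup∘update c row y)

        ∑-bad-≤ : N * ∑ Xs bad ≤ (m ^ 3 * suc k) * (N ^ m) ^ r
        ∑-bad-≤ = begin
          N * ∑ Xs bad                                            ≡⟨ cong (N *_) (∑-swap Xs abcs bad-at) ⟩
          N * ∑ abcs (λ abc → ∑ Xs (λ X → bad-at X abc))          ≡⟨ sym (∑-*ˡ abcs N _) ⟩
          ∑ abcs (λ abc → N * ∑ Xs (λ X → bad-at X abc))          ≤⟨ ∑-mono abcs ∑-bad-at-≤ ⟩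
          ∑ abcs (λ _ → suc k * (N ^ m) ^ r)                      ≡⟨ ∑-const abcs _ ⟩
          length abcs * (suc k * (N ^ m) ^ r)                     ≡⟨ cong (_* (suc k * (N ^ m) ^ r)) (trans (length-tuples (allFin m) 3) (cong (_^ 3) (length-tabulate {n = m} id))) ⟩
          m ^ 3 * (suc k * (N ^ m) ^ r)                           ≡⟨ sym (*-assoc (m ^ 3) (suc k) _) ⟩
          (m ^ 3 * suc k) * (N ^ m) ^ r                           ∎
          where
          open ≤-Reasoning
          abcs = tuples (allFin m) 3

        -- Relative to the number `P` of configurations, `blowup-dense` bounds the total of `good`
        -- from below by `1 / D′`, and `∑-bad-≤` bounds that of `bad` from above by
        -- `m ^ 3 * suc k / N`; `good≤bad` compares the two.
        few-vertices : BergeFree H G → ∀ D → N ^ r ≤ D * #cliques r → N ≤ D ^ (m ^ r) * (m ^ 3 * suc k)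
        few-vertices free D dense = *-cancelʳ-≤ N (D′ * (m ^ 3 * suc k)) P {{m^n≢0 (N ^ m) r {{m^n≢0 N m}}}} (begin
          N * P                                 ≡⟨ cong (N *_) (trans (sym (*-identityʳ P)) (cong (P *_) (sym (^-zeroˡ (m ^ r))))) ⟩
          N * (P * 1 ^ (m ^ r))                 ≤⟨ *-monoʳ-≤ N (blowup-dense (allFin n) m r clique 1 D (≤-trans (≤-reflexive (*-identityʳ _)) dense)) ⟩
          N * (D′ * ∑ Xs good)                  ≤⟨ *-monoʳ-≤ N (*-monoʳ-≤ D′ (∑-mono Xs (good≤bad free))) ⟩
          N * (D′ * ∑ Xs bad)                   ≡⟨ *-leftComm N D′ _ ⟩
          D′ * (N * ∑ Xs bad)                   ≤⟨ *-monoʳ-≤ D′ ∑-bad-≤ ⟩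
          D′ * ((m ^ 3 * suc k) * P)            ≡⟨ sym (*-assoc D′ _ P) ⟩
          (D′ * (m ^ 3 * suc k)) * P            ∎)
          where
          open ≤-Reasoning
          P  = (N ^ m) ^ r
          D′ = D ^ (m ^ r)

  -- From shadow edges to ordered pairs

  length-filterᵇ : ∀ (p : A → Bool) xs → length (filterᵇ p xs) ≡ ∑ xs (λ x → 𝟙 (p x))
  length-filterᵇ p []       = refl
  length-filterᵇ p (x ∷ xs) with p x
  ... | true  = cong suc (length-filterᵇ p xs)
  ... | false = length-filterᵇ p xs

  ∑-pairs : ∀ n (f : Fin n × Fin n → ℕ) →
            ∑ (pairs n) f ≡ ∑ (allFin n) (λ u → ∑ (allFin n) (λ v → 𝟙 (toℕ u <ᵇ toℕ v) * f (u , v)))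
  ∑-pairs n f =
    trans (∑-concatMap (allFin n) _ f) (∑-cong (allFin n) (λ u →
    trans (∑-concatMap (allFin n) _ f) (∑-cong (allFin n) (λ v → at u v (toℕ u <ᵇ toℕ v)))))
    where
    at : ∀ u v b → ∑ (if b then (u , v) ∷ [] else []) f ≡ 𝟙 b * f (u , v)
    at u v true  = refl
    at u v false = refl

  <ᵇ-antisym : ∀ a b → 𝟙 (a <ᵇ b) + 𝟙 (b <ᵇ a) ≤ 1
  <ᵇ-antisym zero    zero    = z≤n
  <ᵇ-antisym zero    (suc b) = ≤-refl
  <ᵇ-antisym (suc a) zero    = ≤-refl
  <ᵇ-antisym (suc a) (suc b) = <ᵇ-antisym a b

  2*[nC2] : ∀ n → 2 * (suc n C 2) ≡ suc n * n
  2*[nC2] zero    = refl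
  2*[nC2] (suc n) = begin
    2 * (suc (suc n) C 2)                  ≡⟨ cong (2 *_) (sym (nCk+nC[k+1]≡[n+1]C[k+1] (suc n) 1)) ⟩
    2 * (suc n C 1 + suc n C 2)            ≡⟨ *-distribˡ-+ 2 (suc n C 1) _ ⟩
    2 * (suc n C 1) + 2 * (suc n C 2)      ≡⟨ cong₂ _+_ (cong (2 *_) (nC1≡n (suc n))) (2*[nC2] n) ⟩
    2 * suc n + suc n * n                  ≡⟨ eq n ⟩
    suc (suc n) * suc n                    ∎
    where
    open ≡-Reasoning
    eq : ∀ n → 2 * suc n + suc n * n ≡ suc (suc n) * suc n
    eq = solve-∀

  module _ {k n} (H : KGraph k n) where
    open Shadow H

    shadowEdge : Fin n × Fin n → Bool
    shadowEdge p = any (λ h → lookup h (proj₁ p) ∧ lookup h (proj₂ p)) hs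

    shadowEdge≤E : ∀ u v → 𝟙 (shadowEdge (u , v)) ≤ E u v
    shadowEdge≤E u v with shadowEdge (u , v) in eq
    ... | false = z≤n
    ... | true  = ≤-reflexive (sym (cong 𝟙 (dec-true (covered? u v) (Any.index w ,
        lookup⇒[]= u _ (Equivalence.to T-≡ (proj₁ both)) , lookup⇒[]= v _ (Equivalence.to T-≡ (proj₂ both))))))
      where
      w = any⁻ (λ h → lookup h u ∧ lookup h v) hs (Equivalence.from T-≡ eq)
      both = Equivalence.to T-∧ (lookup-index w)

    -- Each shadow edge is counted in both orders; `#cliques 2` may be larger because it also counts
    -- loops.
    2*shadowSize≤ : 2 * shadowSize H ≤ #cliques 2
    2*shadowSize≤ = begin
      2 * shadowSize H                                        ≡⟨ cong (λ s → s + (s + 0)) shadow≡ ⟩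
      ∑∑ c + (∑∑ c + 0)                                       ≡⟨ cong (∑∑ c +_) (trans (+-identityʳ _) (∑-swap Vs Vs c)) ⟩
      ∑∑ c + ∑∑ (λ u v → c v u)                               ≡⟨ sym (trans (∑-cong Vs (λ u → ∑-+ Vs (c u) _)) (∑-+ Vs _ _)) ⟩
      ∑∑ (λ u v → c u v + c v u)                              ≤⟨ ∑-mono Vs (λ u → ∑-mono Vs (pointwise u)) ⟩
      ∑∑ E                                                    ≡⟨ sym clique≡ ⟩
      #cliques 2                                              ∎
      where
      open ≤-Reasoning
      Vs = allFin n
      ∑∑ = λ (f : Fin n → Fin n → ℕ) → ∑ Vs (λ u → ∑ Vs (f u))
      c : Fin n → Fin n → ℕ
      c u v = 𝟙 (toℕ u <ᵇ toℕ v) * 𝟙 (shadowEdge (u , v))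
      shadow≡ : shadowSize H ≡ ∑∑ c
      shadow≡ = trans (length-filterᵇ shadowEdge (pairs n)) (∑-pairs n _)
      pointwise : ∀ u v → c u v + c v u ≤ E u v
      pointwise u v = begin
        c u v + c v u ≤⟨ +-mono-≤ (*-monoʳ-≤ (𝟙 (toℕ u <ᵇ toℕ v)) (shadowEdge≤E u v))
                                  (*-monoʳ-≤ (𝟙 (toℕ v <ᵇ toℕ u)) (≤-trans (shadowEdge≤E v u) (≤-reflexive (E-sym v u)))) ⟩
        𝟙 (toℕ u <ᵇ toℕ v) * E u v + 𝟙 (toℕ v <ᵇ toℕ u) * E u v ≡⟨ sym (*-distribʳ-+ (E u v) (𝟙 (toℕ u <ᵇ toℕ v)) _) ⟩
        (𝟙 (toℕ u <ᵇ toℕ v) + 𝟙 (toℕ v <ᵇ toℕ u)) * E u v       ≤⟨ *-monoˡ-≤ (E u v) (<ᵇ-antisym (toℕ u) (toℕ v)) ⟩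
        1 * E u v                                               ≡⟨ *-identityˡ _ ⟩
        E u v                                                   ∎
      clique≡ : #cliques 2 ≡ ∑∑ E
      clique≡ = trans (∑-tuples Vs 1 clique) (∑-cong Vs (λ u → trans (∑-tuples Vs 0 (λ v → clique (u ∷ v)))
        (∑-cong Vs (λ v → eq (E u v)))))
        where
        eq : ∀ e → e * 1 * 1 + 0 ≡ e
        eq = solve-∀

  -- The bound in natural numbers

  module _ {k m d : ℕ} (G : SimpleGraph m) (colorable : Colorable G (suc (suc d))) (q : ℕ) where

    -- Here q + 1 is the denominator of ε, so that ε ≥ 1/((q+1)(d+1)); half of this slack pays for
    -- replacing n(n-1) by n², and clique counting then gives N_{d+2} ≥ n^{d+2} / (2(q+1))^{d+1}.
    threshold : ℕ
    threshold = 2 + 2 * (suc q * d) + ((2 * suc q) ^ suc d) ^ (m ^ suc (suc d)) * (m ^ 3 * suc k)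

    -- The coefficient is 1 - 1/(d+1) + 1/((q+1)(d+1)), cross-multiplied. By contradiction: a larger
    -- shadow gives the hypothesis of `many-cliques` with `e` equal to `suc d`, and the resulting
    -- cliques on d+2 vertices force, by `few-vertices`, fewer than `threshold` vertices.
    shadowSize-≤ : ∀ n → n ≥ threshold → (H : KGraph k n) → BergeFree H G →
                   shadowSize H * (suc q * suc d) ≤ (suc q * d + 1) * (n C 2)
    shadowSize-≤ (suc n) n≥ H free with shadowSize H * (suc q * suc d) ≤? (suc q * d + 1) * (suc n C 2)
    ... | yes le  = le
    ... | no  ¬le = contradiction n≥ (<⇒≱ (s≤s (≤-trans n≤ (m≤n+m _ (suc (2 * (suc q * d)))))))
      where
      open Shadow H
      open Embedding G colorable
      open ≤-Reasoning
      Q = suc q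
      s = shadowSize H
      N≡ : N ≡ suc n
      N≡ = length-tabulate {n = suc n} id
      #cliques-1 : #cliques 1 ≡ suc n
      #cliques-1 = trans (∑-tuples (allFin (suc n)) 0 clique) (trans (sym (length-∑ (allFin (suc n)))) N≡)
      e₁ : ∀ q d x → (2 * suc q) * suc d * x ≡ (1 + 2 * (suc q * d)) * x + (q + suc (q + 0)) * x
      e₁ = solve-∀
      e₂ : ∀ l n → l * (suc n * suc n) ≡ (l * n + l) * suc n
      e₂ = solve-∀
      e₃ : ∀ l n → ((1 + 2 * l) * n + n) * suc n ≡ 2 * ((l + 1) * (suc n * n))
      e₃ = solve-∀
      e₄ : ∀ l c → 2 * (l * (2 * c)) ≡ 4 * (l * c)
      e₄ = solve-∀
      e₅ : ∀ s q d → 4 * (s * (q * d)) ≡ (2 * q) * d * (2 * s)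
      e₅ = solve-∀
      enough : (1 + 2 * (Q * d)) * (suc n * suc n) ≤ (2 * Q) * suc d * #cliques 2
      enough = begin
        (1 + 2 * (Q * d)) * (suc n * suc n)                    ≡⟨ e₂ (1 + 2 * (Q * d)) n ⟩
        -- The first summands of `threshold` give `1 + 2 * (Q * d) ≤ n`, which absorbs the
        -- difference between `suc n * suc n` and `suc n * n`.
        ((1 + 2 * (Q * d)) * n + (1 + 2 * (Q * d))) * suc n    ≤⟨ *-monoˡ-≤ (suc n) (+-monoʳ-≤ ((1 + 2 * (Q * d)) * n) (s≤s⁻¹ (m+n≤o⇒m≤o (2 + 2 * (Q * d)) n≥))) ⟩
        ((1 + 2 * (Q * d)) * n + n) * suc n                    ≡⟨ e₃ (Q * d) n ⟩
        2 * ((Q * d + 1) * (suc n * n))                        ≡⟨ cong (λ z → 2 * ((Q * d + 1) * z)) (sym (2*[nC2] n)) ⟩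
        2 * ((Q * d + 1) * (2 * (suc n C 2)))                  ≡⟨ e₄ (Q * d + 1) (suc n C 2) ⟩
        4 * ((Q * d + 1) * (suc n C 2))                        ≤⟨ *-monoʳ-≤ 4 (<⇒≤ (≰⇒> ¬le)) ⟩
        4 * (s * (Q * suc d))                                  ≡⟨ e₅ s Q (suc d) ⟩
        (2 * Q) * suc d * (2 * s)                              ≤⟨ *-monoʳ-≤ ((2 * Q) * suc d) (2*shadowSize≤ H) ⟩
        (2 * Q) * suc d * #cliques 2                           ∎
      -- q + suc (q + 0) is the predecessor of 2 * Q in the form to which it reduces.
      dense : (2 * Q) * suc d * (N * #cliques 1) ≤ (2 * Q) * suc d * #cliques 2 + (q + suc (q + 0)) * (N * #cliques 1)
      dense = subst (λ x → (2 * Q) * suc d * x ≤ (2 * Q) * suc d * #cliques 2 + (q + suc (q + 0)) * x)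
        (sym (cong₂ _*_ N≡ #cliques-1))
        (≤-trans (≤-reflexive (e₁ q d (suc n * suc n))) (+-monoˡ-≤ _ enough))
      n≤ : suc n ≤ ((2 * Q) ^ suc d) ^ (m ^ suc (suc d)) * (m ^ 3 * suc k)
      n≤ = ≤-trans (≤-reflexive (sym N≡)) (few-vertices free ((2 * Q) ^ suc d)
        (many-cliques (suc d) (q + suc (q + 0)) dense (suc d) ≤-refl))

-- Passing to rational numbers

module Rationals where

  open import Data.Integer using (+_; -_; _+_; _*_; _≤_; +≤+)
  open import Data.Integer.Properties using (pos-*; module ≤-Reasoning)
  import Data.Integer.Tactic.RingSolver as ℤ
  import Data.Nat as ℕ
  import Data.Nat.Properties as ℕ
  import Data.Nat.Tactic.RingSolver as ℕ
  open import Relation.Binary.PropositionalEquality using (sym)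

  open ≤-Reasoning

  -- The cross-multiplied form of s/1 ≤ (1 - 1/(d+1) + p/q) (c/1), as the
  -- operations on unnormalised rationals produce it.
  cross-multiplied : ∀ s d c p q → 1 ℕ.≤ p → s ℕ.* (q ℕ.* suc d) ℕ.≤ (q ℕ.* d ℕ.+ 1) ℕ.* c →
    + s * + ((1 ℕ.* suc d) ℕ.* q ℕ.* 1) ≤
    ((+ 1 * + suc d + - (+ 1) * + 1) * + q + + p * + (1 ℕ.* suc d)) * + c * + 1
  cross-multiplied s d c p q 1≤p le = begin
    + s * + ((1 ℕ.* suc d) ℕ.* q ℕ.* 1)       ≡⟨ sym (pos-* s _) ⟩
    + (s ℕ.* ((1 ℕ.* suc d) ℕ.* q ℕ.* 1))     ≤⟨ +≤+ le′ ⟩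
    + ((d ℕ.* q ℕ.+ p ℕ.* suc d) ℕ.* c)       ≡⟨ pos-* (d ℕ.* q ℕ.+ p ℕ.* suc d) c ⟩
    + (d ℕ.* q ℕ.+ p ℕ.* suc d) * + c         ≡⟨ cong (_* + c) (cong₂ _+_ (pos-* d q) (pos-* p (suc d))) ⟩
    (+ d * + q + + p * + suc d) * + c         ≡⟨ sym (cancel (+ d) (+ q) (+ p * + suc d) (+ c)) ⟩
    ((+ 1 * + suc d + - (+ 1) * + 1) * + q + + p * + suc d) * + c * + 1
                                              ≡⟨ cong (λ e → ((+ 1 * + suc d + - (+ 1) * + 1) * + q + + p * + e) * + c * + 1) (sym (ℕ.*-identityˡ (suc d))) ⟩
    ((+ 1 * + suc d + - (+ 1) * + 1) * + q + + p * + (1 ℕ.* suc d)) * + c * + 1 ∎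
    where
    cancel : ∀ D Q P C → ((+ 1 * (+ 1 + D) + - (+ 1) * + 1) * Q + P) * C * + 1 ≡ (D * Q + P) * C
    cancel = ℤ.solve-∀
    reorder : ∀ s d q → s ℕ.* ((1 ℕ.* d) ℕ.* q ℕ.* 1) ≡ s ℕ.* (q ℕ.* d)
    reorder = ℕ.solve-∀
    le′ : s ℕ.* ((1 ℕ.* suc d) ℕ.* q ℕ.* 1) ℕ.≤ (d ℕ.* q ℕ.+ p ℕ.* suc d) ℕ.* c
    le′ = ℕ.≤-trans (ℕ.≤-reflexive (reorder s (suc d) q)) (ℕ.≤-trans le
      -- Since `p` is at least 1, `p * suc d` is at least the summand 1 in `le`.
      (ℕ.*-monoˡ-≤ c (ℕ.+-mono-≤ (ℕ.≤-reflexive (ℕ.*-comm q d)) (ℕ.*-mono-≤ 1≤p (ℕ.s≤s ℕ.z≤n)))))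

open import Data.Integer as ℤ using (+_)
open import Data.Rational using (ℚ; 0ℚ; 1ℚ; _/_; _+_; _-_; _*_; _≤_; _<_; mkℚ; toℚᵘ; -_; *<*)
open import Data.Nat as ℕ using ()
open import Data.Product using (_,_)
open import Data.Rational.Properties using (toℚᵘ-cancel-≤; toℚᵘ-homo-+; toℚᵘ-homo-*; toℚᵘ-homo‿-; toℚᵘ-fromℚᵘ)
open import Data.Rational.Unnormalised as ℚᵘ using (mkℚᵘ; *≤*)
import Data.Rational.Unnormalised.Properties as ℚᵘ

-- Operations on `ℚ` normalise their results, so the comparison is made in unnormalised rationals,
-- where it is the integer inequality `cross-multiplied`.
ℕ-bound⇒ℚ-bound : ∀ s d c (ε : ℚ) → 0ℚ < ε →
  s ℕ.* (suc (ℚ.denominator-1 ε) ℕ.* suc d) ℕ.≤ (suc (ℚ.denominator-1 ε) ℕ.* d ℕ.+ 1) ℕ.* c →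
  (+ s / 1) ≤ (1ℚ - (+ 1 / suc d) + ε) * (+ c / 1)
-- Positivity excludes the numerator 0, so `ε` is at least the reciprocal of its denominator.
ℕ-bound⇒ℚ-bound s d c (mkℚ (+ 0) q-1 _) (*<* (ℤ.+<+ ())) _
ℕ-bound⇒ℚ-bound s d c ε@(mkℚ (+ suc p) q-1 _) _ le = toℚᵘ-cancel-≤ (begin
  toℚᵘ (+ s / 1)                                                        ≃⟨ toℚᵘ-fromℚᵘ (mkℚᵘ (+ s) 0) ⟩
  mkℚᵘ (+ s) 0                                                          ≤⟨ *≤* (Rationals.cross-multiplied s d c (suc p) (suc q-1) (ℕ.s≤s ℕ.z≤n) le) ⟩
  (mkℚᵘ (+ 1) 0 ℚᵘ.- mkℚᵘ (+ 1) d ℚᵘ.+ mkℚᵘ (+ suc p) q-1) ℚᵘ.* mkℚᵘ (+ c) 0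
    ≃⟨ ℚᵘ.≃-sym (ℚᵘ.≃-trans (toℚᵘ-homo-* (1ℚ - (+ 1 / suc d) + ε) (+ c / 1)) (ℚᵘ.*-cong
         (ℚᵘ.≃-trans (toℚᵘ-homo-+ (1ℚ - (+ 1 / suc d)) ε) (ℚᵘ.+-congˡ (toℚᵘ ε)
           (ℚᵘ.≃-trans (toℚᵘ-homo-+ 1ℚ (- (+ 1 / suc d))) (ℚᵘ.+-congʳ (mkℚᵘ (+ 1) 0)
             (ℚᵘ.≃-trans (toℚᵘ-homo‿- (+ 1 / suc d)) (ℚᵘ.-‿cong (toℚᵘ-fromℚᵘ (mkℚᵘ (+ 1) d))))))))
         (toℚᵘ-fromℚᵘ (mkℚᵘ (+ c) 0)))) ⟩
  toℚᵘ ((1ℚ - (+ 1 / suc d) + ε) * (+ c / 1))                           ∎)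
  where open ℚᵘ.≤-Reasoning

theorem1 : (k : ℕ) → k ≥ 2 →
    (m : ℕ) (G : SimpleGraph m) (d : ℕ) → ChromaticNumber G (suc (suc d)) →
    (ε : ℚ) → 0ℚ < ε →
    ∃ λ n₀ → (n : ℕ) → n ≥ n₀ → (H : KGraph k n) → BergeFree H G →
    (+ shadowSize H / 1) ≤ (1ℚ - (+ 1 / suc d) + ε) * (+ (n C 2) / 1)
theorem1 k _ m G d (colorable , _) ε ε>0 =
  Counting.threshold {k} G colorable (ℚ.denominator-1 ε) ,
  λ n n≥n₀ H free → ℕ-bound⇒ℚ-bound (shadowSize H) d (n C 2) ε ε>0
    (Counting.shadowSize-≤ G colorable (ℚ.denominator-1 ε) n n≥n₀ H free)
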